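{- For all sets $\mathcal{S}$ of sequents and all sequents $\Gamma\Rightarrow\Delta$: $\mathcal{S}\vdash_{\mathsf{G}_{\mathsf{bMDL}}\mathsf{Cut}}\Gamma\Rightarrow\Delta$ if and only if $\{\bigwedge\Sigma\to\bigvee\Pi \mid (\Sigma\Rightarrow\Pi)\in\mathcal{S}\}\vdash_{\mathsf{bMDL}}\bigwedge\Gamma\to\bigvee\Delta$.
   Context: Formulae are built from propositional variables and $\bot$ using the classical connectives $\neg,\land,\lor,\to$, a unary modality $\Box$ and a binary modality $\mathcal{O}(\cdot/\cdot)$. The empty conjunction is $\top:=\bot\to\bot$, the empty disjunction is $\bot$. The logic $\mathsf{bMDL}$ is given by the Hilbert system for modal logic $\mathsf{S4}$ (classical propositional tautologies over the full language, $\Box(\varphi\to\psi)\to(\Box\varphi\to\Box\psi)$, $\Box\varphi\to\varphi$, $\Box\varphi\to\Box\Box\varphi$, modus ponens, necessitation: from $\varphi$ infer $\Box\varphi$) together with the axiom schemata (1) $(\Box(\varphi\to\psi)\land\mathcal{O}(\varphi/\theta))\to\mathcal{O}(\psi/\theta)$; (2) $\Box(\psi\to\neg\varphi)\to\neg(\mathcal{O}(\varphi/\theta)\land\mathcal{O}(\psi/\theta))$; (3) $(\Box((\psi\to\theta)\land(\theta\to\psi))\land\mathcal{O}(\varphi/\psi))\to\mathcal{O}(\varphi/\theta)$. $\mathcal{A}\vdash_{\mathsf{bMDL}}\varphi$ means that $\varphi$ is derivable in this Hilbert system from the (global) assumptions $\mathcal{A}$, i.e. elements of $\mathcal{A}$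 may be used like axioms, and necessitation may be applied to anything derived. A sequent $\Gamma\Rightarrow\Delta$ is a pair of finite multisets of formulae. $\Gamma^{\Box}$ denotes the multiset obtained from $\Gamma$ by deleting every occurrence of a formula not of the form $\Box\varphi$. The calculus $\mathsf{G}_{\mathsf{bMDL}}$ has initial sequents $\Gamma,\varphi\Rightarrow\varphi,\Delta$, the zero-premiss rule $\Gamma,\bot\Rightarrow\Delta$, and the following rules. Propositional rules (principal formula copied into the premisses): ($\neg L$) from $\Gamma,\neg\varphi\Rightarrow\varphi,\Delta$ infer $\Gamma,\neg\varphi\Rightarrow\Delta$; ($\neg R$) from $\Gamma,\varphi\Rightarrow\neg\varphi,\Delta$ infer $\Gamma\Rightarrow\neg\varphi,\Delta$; ($\land L$) from $\Gamma,\varphi\land\psi,\varphi,\psi\Rightarrow\Delta$ infer $\Gamma,\varphi\land\psi\Rightarrow\Delta$; ($\land R$) from $\Gamma\Rightarrow\varphi\land\psi,\varphi,\Delta$ and $\Gamma\Rightarrow\varphi\land\psi,\psi,\Delta$ infer $\Gamma\Rightarrow\varphi\land\psi,\Delta$; ($\lor L$) from $\Gamma,\varphi\lor\psi,\varphi\Rightarrow\Delta$ and $\Gamma,\varphi\lor\psi,\psi\Rightarrow\Delta$ infer $\Gamma,\varphi\lor\psi\Rightarrow\Delta$; ($\lor R$) from $\Gamma\Rightarrow\varphi\lor\psi,\varphi,\psi,\Delta$ infer $\Gamma\Rightarrow\varphi\lor\psi,\Delta$; ($\to L$) from $\Gamma,\varphi\to\psi\Rightarrow\varphi,\Delta$ and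 $\Gamma,\varphi\to\psi,\psi\Rightarrow\Delta$ infer $\Gamma,\varphi\to\psi\Rightarrow\Delta$; ($\to R$) from $\Gamma,\varphi\Rightarrow\varphi\to\psi,\psi,\Delta$ infer $\Gamma\Rightarrow\varphi\to\psi,\Delta$. Modal rules: ($\mathsf{4}$) from $\Gamma^{\Box}\Rightarrow\varphi$ infer $\Gamma\Rightarrow\Box\varphi,\Delta$; ($\mathsf{T}$) from $\Gamma,\Box\varphi,\varphi\Rightarrow\Delta$ infer $\Gamma,\Box\varphi\Rightarrow\Delta$; ($\mathsf{Mon}$) from $\Gamma^{\Box},\varphi\Rightarrow\theta$, $\Gamma^{\Box},\psi\Rightarrow\chi$ and $\Gamma^{\Box},\chi\Rightarrow\psi$ infer $\Gamma,\mathcal{O}(\varphi/\psi)\Rightarrow\mathcal{O}(\theta/\chi),\Delta$; ($\mathsf{D}_1$) from $\Gamma^{\Box},\varphi\Rightarrow$ infer $\Gamma,\mathcal{O}(\varphi/\psi)\Rightarrow\Delta$; ($\mathsf{D}_2$) from $\Gamma^{\Box},\varphi,\theta\Rightarrow$, $\Gamma^{\Box},\psi\Rightarrow\chi$ and $\Gamma^{\Box},\chi\Rightarrow\psi$ infer $\Gamma,\mathcal{O}(\varphi/\psi),\mathcal{O}(\theta/\chi)\Rightarrow\Delta$. The cut rule is ($\mathsf{Cut}$): from $\Gamma\Rightarrow\varphi,\Delta$ and $\Sigma,\varphi\Rightarrow\Pi$ infer $\Gamma,\Sigma\Rightarrow\Delta,\Pi$. For a set $\mathcal{S}$ of sequents,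 $\mathcal{S}\vdash_{\mathsf{G}_{\mathsf{bMDL}}\mathsf{Cut}}\Gamma\Rightarrow\Delta$ means that there is a derivation of $\Gamma\Rightarrow\Delta$ using the rules of $\mathsf{G}_{\mathsf{bMDL}}$ and $\mathsf{Cut}$, with leaves labelled by initial sequents, zero-premiss rules or sequents from $\mathcal{S}$.
   Formalization: The "if" direction is proved only for sets S not containing the empty sequent; without this it fails: for S = {⇒}, the Hilbert system derives ⊤→⊥, but ⇒ ⊥ is not derivable since ⇒ is never a premiss of any rule. The "only if" direction holds for all S. -}

module Defs where

open import Data.Bool using (Bool; true; false; not; _∧_; _∨_)
open import Data.List using (List; []; _∷_; [_]; _++_; filter)
open import Data.List.Relation.Binary.Permutation.Propositional using (_↭_)
open import Data.Nat using (ℕ)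
open import Data.Product using (_×_; _,_; ∃-syntax)
open import Level using (Level; 0ℓ)
open import Relation.Binary.PropositionalEquality using (_≡_)
open import Relation.Nullary using (yes; no)
open import Relation.Unary using (Pred; Decidable; _∈_)

private
  variable
    ℓ : Level

infix  30 ~_ □_
infixr 28 _⋏_
infixr 27 _⋎_
infixr 26 _⊃_
infix  4 _⇒_
infix  3 _⊢_ _⊢ᴳᶜ_

data Formula : Set where
  var     : ℕ → Formula
  ⊥ᶠ      : Formula
  ~_      : Formula → Formula
  _⋏_     : Formula → Formula → Formula
  _⋎_     : Formula → Formula → Formula
  _⊃_     : Formula → Formula → Formula
  □_      : Formula → Formula
  𝒪⟨_/_⟩  : Formula → Formula → Formula

⊤ᶠ : Formula
⊤ᶠ = ⊥ᶠ ⊃ ⊥ᶠ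

⋀ : List Formula → Formula
⋀ []          = ⊤ᶠ
⋀ (φ ∷ [])    = φ
⋀ (φ ∷ ψ ∷ Γ) = φ ⋏ ⋀ (ψ ∷ Γ)

⋁ : List Formula → Formula
⋁ []          = ⊥ᶠ
⋁ (φ ∷ [])    = φ
⋁ (φ ∷ ψ ∷ Δ) = φ ⋎ ⋁ (ψ ∷ Δ)

-- Variables and formulae with an outermost modality are evaluated by v as
-- independent atoms; v is never consulted on other formulae.
eval : (Formula → Bool) → Formula → Bool
eval v (var p)      = v (var p)
eval v ⊥ᶠ           = false
eval v (~ φ)        = not (eval v φ)
eval v (φ ⋏ ψ)      = eval v φ ∧ eval v ψ
eval v (φ ⋎ ψ)      = eval v φ ∨ eval v ψ
eval v (φ ⊃ ψ)      = not (eval v φ) ∨ eval v ψ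
eval v (□ φ)        = v (□ φ)
eval v 𝒪⟨ φ / ψ ⟩   = v 𝒪⟨ φ / ψ ⟩

Tautology : Pred Formula 0ℓ
Tautology φ = ∀ v → eval v φ ≡ true

data _⊢_ (𝒜 : Pred Formula ℓ) : Formula → Set ℓ where
  assumption : ∀ {φ} → φ ∈ 𝒜 → 𝒜 ⊢ φ
  tautology  : ∀ {φ} → Tautology φ → 𝒜 ⊢ φ
  axiomK     : ∀ φ ψ → 𝒜 ⊢ □ (φ ⊃ ψ) ⊃ (□ φ ⊃ □ ψ)
  axiomT     : ∀ φ → 𝒜 ⊢ □ φ ⊃ φ
  axiom4     : ∀ φ → 𝒜 ⊢ □ φ ⊃ □ (□ φ)
  axiom𝒪₁    : ∀ φ ψ θ → 𝒜 ⊢ (□ (φ ⊃ ψ) ⋏ 𝒪⟨ φ / θ ⟩) ⊃ 𝒪⟨ ψ / θ ⟩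
  axiom𝒪₂    : ∀ φ ψ θ → 𝒜 ⊢ □ (ψ ⊃ ~ φ) ⊃ ~ (𝒪⟨ φ / θ ⟩ ⋏ 𝒪⟨ ψ / θ ⟩)
  axiom𝒪₃    : ∀ φ ψ θ →
    𝒜 ⊢ (□ ((ψ ⊃ θ) ⋏ (θ ⊃ ψ)) ⋏ 𝒪⟨ φ / ψ ⟩) ⊃ 𝒪⟨ φ / θ ⟩
  mp         : ∀ {φ ψ} → 𝒜 ⊢ φ ⊃ ψ → 𝒜 ⊢ φ → 𝒜 ⊢ ψ
  nec        : ∀ {φ} → 𝒜 ⊢ φ → 𝒜 ⊢ □ φ

-- Lists stand for finite multisets: derivability of sequents is closed under
-- permutation (rule exch below), so a set of sequents may be given by any
-- choice of list representatives of its members.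
record Sequent : Set where
  constructor _⇒_
  field
    antecedent : List Formula
    succedent  : List Formula

data IsBoxed : Pred Formula 0ℓ where
  boxed : ∀ φ → IsBoxed (□ φ)

isBoxed? : Decidable IsBoxed
isBoxed? (var _)     = no λ ()
isBoxed? ⊥ᶠ          = no λ ()
isBoxed? (~ _)       = no λ ()
isBoxed? (_ ⋏ _)     = no λ ()
isBoxed? (_ ⋎ _)     = no λ ()
isBoxed? (_ ⊃ _)     = no λ ()
isBoxed? (□ φ)       = yes (boxed φ)
isBoxed? 𝒪⟨ _ / _ ⟩  = no λ ()

infix 32 _^□

_^□ : List Formula → List Formula
Γ ^□ = filter isBoxed? Γ

-- Side formulae are written to the right of the active ones on both sides of
-- a sequent; exch makes the position immaterial.
--
-- Weakening is not primitive, and no rule other than exch admits the empty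
-- sequent as a premiss.  Hence a leaf [] ⇒ [] contributes to no other
-- conclusion, although its formula ⊤ᶠ ⊃ ⊥ᶠ makes _⊢_ inconsistent: from
-- 𝒮 = { [] ⇒ [] } one cannot derive [] ⇒ [ ⊥ᶠ ].
data _⊢ᴳᶜ_ (𝒮 : Pred Sequent ℓ) : Sequent → Set ℓ where
  leaf : ∀ {s} → s ∈ 𝒮 → 𝒮 ⊢ᴳᶜ s
  exch : ∀ {Γ Γ′ Δ Δ′} → Γ ↭ Γ′ → Δ ↭ Δ′ →
         𝒮 ⊢ᴳᶜ Γ ⇒ Δ → 𝒮 ⊢ᴳᶜ Γ′ ⇒ Δ′
  init : ∀ {Γ Δ φ} → 𝒮 ⊢ᴳᶜ φ ∷ Γ ⇒ φ ∷ Δ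
  ⊥L   : ∀ {Γ Δ} → 𝒮 ⊢ᴳᶜ ⊥ᶠ ∷ Γ ⇒ Δ
  ¬L   : ∀ {Γ Δ φ} →
         𝒮 ⊢ᴳᶜ ~ φ ∷ Γ ⇒ φ ∷ Δ →
         𝒮 ⊢ᴳᶜ ~ φ ∷ Γ ⇒ Δ
  ¬R   : ∀ {Γ Δ φ} →
         𝒮 ⊢ᴳᶜ φ ∷ Γ ⇒ ~ φ ∷ Δ →
         𝒮 ⊢ᴳᶜ Γ ⇒ ~ φ ∷ Δ
  ∧L   : ∀ {Γ Δ φ ψ} →
         𝒮 ⊢ᴳᶜ φ ⋏ ψ ∷ φ ∷ ψ ∷ Γ ⇒ Δ →
         𝒮 ⊢ᴳᶜ φ ⋏ ψ ∷ Γ ⇒ Δ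
  ∧R   : ∀ {Γ Δ φ ψ} →
         𝒮 ⊢ᴳᶜ Γ ⇒ φ ⋏ ψ ∷ φ ∷ Δ →
         𝒮 ⊢ᴳᶜ Γ ⇒ φ ⋏ ψ ∷ ψ ∷ Δ →
         𝒮 ⊢ᴳᶜ Γ ⇒ φ ⋏ ψ ∷ Δ
  ∨L   : ∀ {Γ Δ φ ψ} →
         𝒮 ⊢ᴳᶜ φ ⋎ ψ ∷ φ ∷ Γ ⇒ Δ →
         𝒮 ⊢ᴳᶜ φ ⋎ ψ ∷ ψ ∷ Γ ⇒ Δ →
         𝒮 ⊢ᴳᶜ φ ⋎ ψ ∷ Γ ⇒ Δ
  ∨R   : ∀ {Γ Δ φ ψ} →
         𝒮 ⊢ᴳᶜ Γ ⇒ φ ⋎ ψ ∷ φ ∷ ψ ∷ Δ →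
         𝒮 ⊢ᴳᶜ Γ ⇒ φ ⋎ ψ ∷ Δ
  →L   : ∀ {Γ Δ φ ψ} →
         𝒮 ⊢ᴳᶜ φ ⊃ ψ ∷ Γ ⇒ φ ∷ Δ →
         𝒮 ⊢ᴳᶜ φ ⊃ ψ ∷ ψ ∷ Γ ⇒ Δ →
         𝒮 ⊢ᴳᶜ φ ⊃ ψ ∷ Γ ⇒ Δ
  →R   : ∀ {Γ Δ φ ψ} →
         𝒮 ⊢ᴳᶜ φ ∷ Γ ⇒ φ ⊃ ψ ∷ ψ ∷ Δ →
         𝒮 ⊢ᴳᶜ Γ ⇒ φ ⊃ ψ ∷ Δ
  □4   : ∀ {Γ Δ φ} →
         𝒮 ⊢ᴳᶜ Γ ^□ ⇒ [ φ ] →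
         𝒮 ⊢ᴳᶜ Γ ⇒ □ φ ∷ Δ
  □T   : ∀ {Γ Δ φ} →
         𝒮 ⊢ᴳᶜ □ φ ∷ φ ∷ Γ ⇒ Δ →
         𝒮 ⊢ᴳᶜ □ φ ∷ Γ ⇒ Δ
  Mon  : ∀ {Γ Δ φ ψ θ χ} →
         𝒮 ⊢ᴳᶜ φ ∷ Γ ^□ ⇒ [ θ ] →
         𝒮 ⊢ᴳᶜ ψ ∷ Γ ^□ ⇒ [ χ ] →
         𝒮 ⊢ᴳᶜ χ ∷ Γ ^□ ⇒ [ ψ ] →
         𝒮 ⊢ᴳᶜ 𝒪⟨ φ / ψ ⟩ ∷ Γ ⇒ 𝒪⟨ θ / χ ⟩ ∷ Δ
  D₁   : ∀ {Γ Δ φ ψ} →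
         𝒮 ⊢ᴳᶜ φ ∷ Γ ^□ ⇒ [] →
         𝒮 ⊢ᴳᶜ 𝒪⟨ φ / ψ ⟩ ∷ Γ ⇒ Δ
  D₂   : ∀ {Γ Δ φ ψ θ χ} →
         𝒮 ⊢ᴳᶜ φ ∷ θ ∷ Γ ^□ ⇒ [] →
         𝒮 ⊢ᴳᶜ ψ ∷ Γ ^□ ⇒ [ χ ] →
         𝒮 ⊢ᴳᶜ χ ∷ Γ ^□ ⇒ [ ψ ] →
         𝒮 ⊢ᴳᶜ 𝒪⟨ φ / ψ ⟩ ∷ 𝒪⟨ θ / χ ⟩ ∷ Γ ⇒ Δ
  cut  : ∀ {Γ Δ Σ Π φ} →
         𝒮 ⊢ᴳᶜ Γ ⇒ φ ∷ Δ →
         𝒮 ⊢ᴳᶜ φ ∷ Σ ⇒ Π →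
         𝒮 ⊢ᴳᶜ Γ ++ Σ ⇒ Δ ++ Π

⌊_⌋ : Sequent → Formula
⌊ Γ ⇒ Δ ⌋ = ⋀ Γ ⊃ ⋁ Δ

Interpretations : Pred Sequent ℓ → Pred Formula ℓ
Interpretations 𝒮 φ = ∃[ s ] s ∈ 𝒮 × φ ≡ ⌊ s ⌋

{-# OPTIONS --safe #-}

-- Soundness: propositional rules are tautological consequences, and for the
-- modal rules a derivation of ⋀ (Γ ^□) ⊃ ψ yields one of ⋀ Γ ⊃ □ ψ by K and 4.
--
-- Completeness: weakening and contraction are not rules, and leaves taken from
-- 𝒮 block the usual induction on derivations. Both are recovered from cut:
-- a nonempty leaf is weakened by cutting it against an initial sequent, and a
-- double occurrence of φ is merged into φ ⋏ φ (or φ ⋎ φ), which is then cut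
-- against φ ⇒ φ ⋏ φ (or φ ⋎ φ ⇒ φ). Tautologies are derived by Kalmár's
-- argument: a valuation settles φ from its literals, and the literals are
-- then eliminated by cuts.

module Submission where

open import Defs
open import Data.Bool using (Bool; true; false; not; _∧_; _∨_; if_then_else_)
open import Data.Bool.Properties using () renaming (_≟_ to _≟ᵇ_)
open import Data.Empty using (⊥-elim)
open import Data.List using (List; []; _∷_; [_]; _++_)
open import Data.List.Membership.Propositional using (_∈_)
open import Data.List.Membership.Propositional.Properties using (∈-∃++)
open import Data.List.Properties using (filter-++; ++-assoc)
open import Data.List.Relation.Binary.Permutation.Propositional
  using (_↭_; ↭-refl; ↭-sym; ↭-reflexive; prep; swap)
open import Data.List.Relation.Binary.Permutation.Propositional.Properties
  using (All-resp-↭; Any-resp-↭; shift; ++-comm; ++⁺ʳ)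
open import Data.List.Relation.Binary.Subset.Propositional using (_⊆_)
open import Data.List.Relation.Binary.Subset.Propositional.Properties
  using (xs⊆xs++ys; xs⊆ys++xs)
open import Data.List.Relation.Unary.All as All using (All; []; _∷_)
open import Data.List.Relation.Unary.All.Properties as All using ()
open import Data.List.Relation.Unary.Any as Any using (Any; here; there)
open import Data.List.Relation.Unary.Any.Properties as Any using ()
open import Data.Nat using (ℕ; zero; suc)
open import Data.Nat.Properties using () renaming (_≟_ to _≟ⁿ_)
open import Data.Product using (_×_; _,_; proj₁; proj₂)
open import Data.Sum using (_⊎_; inj₁; inj₂; [_,_]′)
open import Function using (_∘_; id; const)
open import Level using (Level)
open import Relation.Binary.PropositionalEquality
  using (_≡_; _≢_; refl; sym; trans; cong; cong₂; subst)
open import Relation.Nullary using (¬_; Dec; yes; no; does; contradiction)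
open import Relation.Nullary.Decidable using (map′; dec-true; dec-false; _×-dec_; toSum)
open import Relation.Unary using (Pred; _∉_)

private
  variable
    ℓ : Level
    v : Formula → Bool
    φ ψ θ χ : Formula
    Γ Δ Σ Π : List Formula
    s t u : Sequent

-- Soundness

infix 4 _⊨_
infix 3 _⊨ˢ_ _⊢ˢ_

-- A record rather than the bare equation, so that φ can be inferred.
record _⊨_ (v : Formula → Bool) (φ : Formula) : Set where
  constructor holds
  field
    value : eval v φ ≡ true

open _⊨_

_⊨?_ : ∀ v φ → Dec (v ⊨ φ)
v ⊨? φ = map′ holds value (eval v φ ≟ᵇ true)

⊨⊥-elim : ¬ v ⊨ ⊥ᶠ
⊨⊥-elim (holds ())

⊨~-intro : ¬ v ⊨ φ → v ⊨ ~ φ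
⊨~-intro {v} {φ} ¬p with eval v φ in eq
... | true  = contradiction (holds eq) ¬p
... | false = holds (cong not eq)

⊨~-elim : v ⊨ ~ φ → ¬ v ⊨ φ
⊨~-elim {v} {φ} (holds n) (holds p) with eval v φ
⊨~-elim (holds ()) (holds refl) | true

⊨⋏-intro : v ⊨ φ → v ⊨ ψ → v ⊨ φ ⋏ ψ
⊨⋏-intro (holds p) (holds q) = holds (cong₂ _∧_ p q)

⊨⋏-elim : v ⊨ φ ⋏ ψ → v ⊨ φ × v ⊨ ψ
⊨⋏-elim {v} {φ} {ψ} (holds p) with eval v φ in eq
... | true = holds eq , holds p

⊨⋎-introˡ : v ⊨ φ → v ⊨ φ ⋎ ψ
⊨⋎-introˡ {v} {φ} {ψ} (holds p) = holds (cong (_∨ eval v ψ) p)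

⊨⋎-introʳ : v ⊨ ψ → v ⊨ φ ⋎ ψ
⊨⋎-introʳ {v} {ψ} {φ} (holds q) with eval v φ in eq
... | true  = ⊨⋎-introˡ (holds eq)
... | false = holds (trans (cong (_∨ eval v ψ) eq) q)

⊨⋎-elim : v ⊨ φ ⋎ ψ → v ⊨ φ ⊎ v ⊨ ψ
⊨⋎-elim {v} {φ} (holds p) with eval v φ in eq
... | true  = inj₁ (holds eq)
... | false = inj₂ (holds p)

⊨⊃-intro : (v ⊨ φ → v ⊨ ψ) → v ⊨ φ ⊃ ψ
⊨⊃-intro {v} {φ} {ψ} f with eval v φ in eq
... | true  = holds (trans (cong (λ b → not b ∨ eval v ψ) eq) (value (f (holds eq))))
... | false = holds (cong (λ b → not b ∨ eval v ψ) eq)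

⊨⊃-elim : v ⊨ φ ⊃ ψ → v ⊨ φ → v ⊨ ψ
⊨⊃-elim {v} {φ} (holds f) (holds p) with eval v φ
⊨⊃-elim (holds f) (holds refl) | true = holds f

⊨⋀-intro : All (v ⊨_) Γ → v ⊨ ⋀ Γ
⊨⋀-intro []            = holds refl
⊨⋀-intro (p ∷ [])      = p
⊨⋀-intro (p ∷ (q ∷ γ)) = ⊨⋏-intro p (⊨⋀-intro (q ∷ γ))

⊨⋀-elim : ∀ Γ → v ⊨ ⋀ Γ → All (v ⊨_) Γ
⊨⋀-elim []          p = []
⊨⋀-elim (_ ∷ [])    p = p ∷ []
⊨⋀-elim (_ ∷ ψ ∷ Γ) p = proj₁ (⊨⋏-elim p) ∷ ⊨⋀-elim (ψ ∷ Γ) (proj₂ (⊨⋏-elim p))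

⊨⋁-intro : Any (v ⊨_) Δ → v ⊨ ⋁ Δ
⊨⋁-intro {Δ = _ ∷ []}    (here p)  = p
⊨⋁-intro {Δ = _ ∷ _ ∷ _} (here p)  = ⊨⋎-introˡ p
⊨⋁-intro {Δ = _ ∷ _ ∷ _} (there p) = ⊨⋎-introʳ (⊨⋁-intro p)

⊨⋁-elim : ∀ Δ → v ⊨ ⋁ Δ → Any (v ⊨_) Δ
⊨⋁-elim []          p = ⊥-elim (⊨⊥-elim p)
⊨⋁-elim (_ ∷ [])    p = here p
⊨⋁-elim (_ ∷ ψ ∷ Δ) p = [ here , there ∘ ⊨⋁-elim (ψ ∷ Δ) ]′ (⊨⋎-elim p)

-- Stating truth of a sequent with `All` and `Any` lets the rules act on lists; the special
-- singleton clauses of `⋀` and `⋁` then matter only in the conversions to and from `⌊_⌋`.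
_⊨ˢ_ : (Formula → Bool) → Sequent → Set
v ⊨ˢ (Γ ⇒ Δ) = All (v ⊨_) Γ → Any (v ⊨_) Δ

⊨ˢ⇒⊨ : v ⊨ˢ s → v ⊨ ⌊ s ⌋
⊨ˢ⇒⊨ {s = Γ ⇒ Δ} f = ⊨⊃-intro (⊨⋁-intro ∘ f ∘ ⊨⋀-elim Γ)

⊨⇒⊨ˢ : v ⊨ ⌊ s ⌋ → v ⊨ˢ s
⊨⇒⊨ˢ {s = Γ ⇒ Δ} p = ⊨⋁-elim Δ ∘ ⊨⊃-elim p ∘ ⊨⋀-intro

-- Sequents cannot be inferred from ⌊_⌋, hence the wrapper.
record _⊢ˢ_ (𝒜 : Pred Formula ℓ) (s : Sequent) : Set ℓ where
  constructor interpreted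
  field
    derivation : 𝒜 ⊢ ⌊ s ⌋

open _⊢ˢ_

-- Tautological consequence in the Hilbert system and soundness of the modal rules

module _ {𝒜 : Pred Formula ℓ} where

  -- Each premiss becomes the antecedent of an implication until a tautology remains, and modus
  -- ponens discharges the antecedents. Propositional steps thus reduce to reasoning about a single
  -- valuation.
  consequence : ∀ {Φ} → (∀ {v} → All (v ⊨_) Φ → v ⊨ ψ) → All (𝒜 ⊢_) Φ → 𝒜 ⊢ ψ
  consequence f []       = tautology λ v → value (f [])
  consequence f (d ∷ ds) = mp (consequence (λ ps → ⊨⊃-intro (λ p → f (p ∷ ps))) ds) d

  rule₀ : (∀ {v} → v ⊨ˢ s) → 𝒜 ⊢ˢ s
  rule₀ {s} f = interpreted (consequence (λ _ → ⊨ˢ⇒⊨ {s = s} f) [])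

  -- Truth is preserved at each valuation separately. This fits the propositional rules, exchange
  -- and cut; the modal rules go beyond it, since boxed formulae are atoms for `v`.
  rule₁ : (∀ {v} → v ⊨ˢ s → v ⊨ˢ t) → 𝒜 ⊢ˢ s → 𝒜 ⊢ˢ t
  rule₁ {s} {t} f d = interpreted (consequence
    (λ { (p ∷ []) → ⊨ˢ⇒⊨ {s = t} (f (⊨⇒⊨ˢ {s = s} p)) }) (derivation d ∷ []))

  rule₂ : (∀ {v} → v ⊨ˢ s → v ⊨ˢ t → v ⊨ˢ u) → 𝒜 ⊢ˢ s → 𝒜 ⊢ˢ t → 𝒜 ⊢ˢ u
  rule₂ {s} {t} {u} f d e = interpreted (consequence
    (λ { (p ∷ q ∷ []) → ⊨ˢ⇒⊨ {s = u} (f (⊨⇒⊨ˢ {s = s} p) (⊨⇒⊨ˢ {s = t} q)) })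
    (derivation d ∷ derivation e ∷ []))

  ⋀-tail : ∀ φ Γ → 𝒜 ⊢ ⋀ Γ ⊃ ψ → 𝒜 ⊢ ⋀ (φ ∷ Γ) ⊃ ψ
  ⋀-tail φ Γ d = consequence
    (λ { (p ∷ []) → ⊨⊃-intro (⊨⊃-elim p ∘ ⊨⋀-intro ∘ All.tail ∘ ⊨⋀-elim (φ ∷ Γ)) }) (d ∷ [])

  ⋀-curry : ∀ φ Γ → 𝒜 ⊢ ⋀ (φ ∷ Γ) ⊃ ψ → 𝒜 ⊢ ⋀ Γ ⊃ (φ ⊃ ψ)
  ⋀-curry φ Γ d = consequence
    (λ { (p ∷ []) → ⊨⊃-intro (λ γ → ⊨⊃-intro (λ q → ⊨⊃-elim p (⊨⋀-intro (q ∷ ⊨⋀-elim Γ γ)))) })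
    (d ∷ [])

  -- Necessitation requires an empty antecedent, so formulae leave it one at a time. An unboxed one
  -- is absent from `Γ ^□` and returns by weakening. A boxed `□ χ` moves into the conclusion as
  -- `□ χ ⊃ ψ`; after K this asks for `□ (□ χ)`, which axiom 4 supplies.
  □-intro : ∀ Γ → 𝒜 ⊢ ⋀ (Γ ^□) ⊃ ψ → 𝒜 ⊢ ⋀ Γ ⊃ □ ψ
  □-intro [] d = consequence (λ { (p ∷ []) → ⊨⊃-intro (const p) })
    (nec (mp d (tautology λ _ → refl)) ∷ [])
  □-intro {ψ} (φ ∷ Γ) d with isBoxed? φ
  ... | no _          = ⋀-tail φ Γ (□-intro Γ d)
  ... | yes (boxed χ) = consequence
    (λ { (k ∷ f ∷ i ∷ []) → ⊨⊃-intro λ γ → let ps = ⊨⋀-elim (□ χ ∷ Γ) γ in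
         ⊨⊃-elim (⊨⊃-elim k (⊨⊃-elim i (⊨⋀-intro (All.tail ps)))) (⊨⊃-elim f (All.head ps)) })
    (axiomK (□ χ) ψ ∷ axiom4 χ ∷ □-intro Γ (⋀-curry (□ χ) (Γ ^□) d) ∷ [])

  □⊃-intro : ∀ Γ → 𝒜 ⊢ˢ φ ∷ Γ ^□ ⇒ [ ψ ] → 𝒜 ⊢ ⋀ Γ ⊃ □ (φ ⊃ ψ)
  □⊃-intro Γ d = □-intro Γ (⋀-curry _ (Γ ^□) (derivation d))

  □⇔-intro : ∀ Γ → 𝒜 ⊢ˢ φ ∷ Γ ^□ ⇒ [ ψ ] → 𝒜 ⊢ˢ ψ ∷ Γ ^□ ⇒ [ φ ] →
             𝒜 ⊢ ⋀ Γ ⊃ □ ((φ ⊃ ψ) ⋏ (ψ ⊃ φ))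
  □⇔-intro Γ d e = □-intro Γ (consequence
    (λ { (p ∷ q ∷ []) → ⊨⊃-intro λ γ → ⊨⋏-intro (⊨⊃-elim p γ) (⊨⊃-elim q γ) })
    (⋀-curry _ (Γ ^□) (derivation d) ∷ ⋀-curry _ (Γ ^□) (derivation e) ∷ []))

  □4-sound : 𝒜 ⊢ˢ Γ ^□ ⇒ [ φ ] → 𝒜 ⊢ˢ Γ ⇒ □ φ ∷ Δ
  □4-sound {Γ} {φ} {Δ} d = interpreted (consequence
    (λ { (p ∷ []) → ⊨ˢ⇒⊨ {s = Γ ⇒ □ φ ∷ Δ} (here ∘ ⊨⊃-elim p ∘ ⊨⋀-intro) })
    (□-intro Γ (derivation d) ∷ []))

  □T-sound : 𝒜 ⊢ˢ □ φ ∷ φ ∷ Γ ⇒ Δ → 𝒜 ⊢ˢ □ φ ∷ Γ ⇒ Δ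
  □T-sound {φ} {Γ} {Δ} d = interpreted (consequence
    (λ { (t ∷ p ∷ []) → ⊨ˢ⇒⊨ {s = □ φ ∷ Γ ⇒ Δ}
         λ { (b ∷ γ) → ⊨⇒⊨ˢ {s = □ φ ∷ φ ∷ Γ ⇒ Δ} p (b ∷ ⊨⊃-elim t b ∷ γ) } })
    (axiomT φ ∷ derivation d ∷ []))

  -- The first obligation axiom replaces `φ` by `θ` under the condition `ψ`; the third then
  -- exchanges `ψ` for the equivalent `χ`.
  Mon-sound : 𝒜 ⊢ˢ φ ∷ Γ ^□ ⇒ [ θ ] → 𝒜 ⊢ˢ ψ ∷ Γ ^□ ⇒ [ χ ] → 𝒜 ⊢ˢ χ ∷ Γ ^□ ⇒ [ ψ ] →
              𝒜 ⊢ˢ 𝒪⟨ φ / ψ ⟩ ∷ Γ ⇒ 𝒪⟨ θ / χ ⟩ ∷ Δ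
  Mon-sound {φ} {Γ} {θ} {ψ} {χ} {Δ} d e f = interpreted (consequence
    (λ { (p ∷ q ∷ a₁ ∷ a₃ ∷ []) → ⊨ˢ⇒⊨ {s = 𝒪⟨ φ / ψ ⟩ ∷ Γ ⇒ 𝒪⟨ θ / χ ⟩ ∷ Δ}
         λ { (o ∷ γ) → let g = ⊨⋀-intro γ in
             here (⊨⊃-elim a₃ (⊨⋏-intro (⊨⊃-elim q g)
                    (⊨⊃-elim a₁ (⊨⋏-intro (⊨⊃-elim p g) o)))) } })
    (□⊃-intro Γ d ∷ □⇔-intro Γ e f ∷ axiom𝒪₁ φ θ ψ ∷ axiom𝒪₃ θ ψ χ ∷ []))

  D₁-sound : 𝒜 ⊢ˢ φ ∷ Γ ^□ ⇒ [] → 𝒜 ⊢ˢ 𝒪⟨ φ / ψ ⟩ ∷ Γ ⇒ Δ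
  D₁-sound {φ} {Γ} {ψ} {Δ} d = interpreted (consequence
    (λ { (p ∷ a₂ ∷ []) → ⊨ˢ⇒⊨ {s = 𝒪⟨ φ / ψ ⟩ ∷ Γ ⇒ Δ}
         λ { (o ∷ γ) → ⊥-elim (⊨~-elim (⊨⊃-elim a₂ (⊨⊃-elim p (⊨⋀-intro γ))) (⊨⋏-intro o o)) } })
    -- The empty succedent is weakened to `~ φ`, and the second obligation axiom is used with both
    -- of its obligations equal.
    (□⊃-intro Γ (rule₁ (λ { f (p ∷ γ) → ⊥-elim (Any.¬Any[] (f (p ∷ γ))) }) d) ∷ axiom𝒪₂ φ φ ψ ∷ []))

  D₂-sound : 𝒜 ⊢ˢ φ ∷ θ ∷ Γ ^□ ⇒ [] → 𝒜 ⊢ˢ ψ ∷ Γ ^□ ⇒ [ χ ] → 𝒜 ⊢ˢ χ ∷ Γ ^□ ⇒ [ ψ ] →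
             𝒜 ⊢ˢ 𝒪⟨ φ / ψ ⟩ ∷ 𝒪⟨ θ / χ ⟩ ∷ Γ ⇒ Δ
  D₂-sound {φ} {θ} {Γ} {ψ} {χ} {Δ} d e f = interpreted (consequence
    (λ { (p ∷ q ∷ a₂ ∷ a₃ ∷ []) → ⊨ˢ⇒⊨ {s = 𝒪⟨ φ / ψ ⟩ ∷ 𝒪⟨ θ / χ ⟩ ∷ Γ ⇒ Δ}
         λ { (o ∷ o′ ∷ γ) → let g = ⊨⋀-intro γ in
             ⊥-elim (⊨~-elim (⊨⊃-elim a₂ (⊨⊃-elim p g))
                      (⊨⋏-intro (⊨⊃-elim a₃ (⊨⋏-intro (⊨⊃-elim q g) o)) o′)) } })
    -- Moving `φ` to the right as `~ φ` gives `□ (θ ⊃ ~ φ)`; the third obligation axiom brings both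
    -- obligations under the condition `χ`.
    (□⊃-intro Γ (rule₁ (λ { g (r ∷ γ) → here (⊨~-intro λ p → Any.¬Any[] (g (p ∷ r ∷ γ))) }) d)
      ∷ □⇔-intro Γ e f ∷ axiom𝒪₂ φ θ χ ∷ axiom𝒪₃ φ ψ χ ∷ []))

-- Soundness by induction on sequent derivations

module _ {𝒮 : Pred Sequent ℓ} where

  sound : 𝒮 ⊢ᴳᶜ s → Interpretations 𝒮 ⊢ˢ s
  sound (leaf m) = interpreted (assumption (_ , m , refl))
  sound (exch Γ↭ Δ↭ d) =
    rule₁ (λ f → Any-resp-↭ Δ↭ ∘ f ∘ All-resp-↭ (↭-sym Γ↭)) (sound d)
  sound init = rule₀ λ { (p ∷ _) → here p }
  sound ⊥L = rule₀ λ { (p ∷ _) → ⊥-elim (⊨⊥-elim p) }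
  sound (¬L d) = rule₁
    (λ { f (n ∷ γ) → [ ⊥-elim ∘ ⊨~-elim n , id ]′ (Any.toSum (f (n ∷ γ))) }) (sound d)
  sound (¬R {φ = φ} d) = rule₁
    (λ {v} f γ → [ (λ p → f (p ∷ γ)) , here ∘ ⊨~-intro ]′ (toSum (v ⊨? φ))) (sound d)
  sound (∧L d) = rule₁
    (λ { f (p ∷ γ) → f (p ∷ proj₁ (⊨⋏-elim p) ∷ proj₂ (⊨⋏-elim p) ∷ γ) }) (sound d)
  sound (∧R d e) = rule₂ (λ f g γ → both (f γ) (g γ)) (sound d) (sound e)
    where
    both : Any (v ⊨_) (φ ⋏ ψ ∷ φ ∷ Δ) → Any (v ⊨_) (φ ⋏ ψ ∷ ψ ∷ Δ) → Any (v ⊨_) (φ ⋏ ψ ∷ Δ)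
    both (here p)          _                 = here p
    both (there (there p)) _                 = there p
    both (there (here _))  (here q)          = here q
    both (there (here p))  (there (here q))  = here (⊨⋏-intro p q)
    both (there (here _))  (there (there q)) = there q
  sound (∨L d e) = rule₂
    (λ { f g (p ∷ γ) → [ (λ q → f (p ∷ q ∷ γ)) , (λ q → g (p ∷ q ∷ γ)) ]′ (⊨⋎-elim p) })
    (sound d) (sound e)
  sound (∨R d) = rule₁ (λ f → merge ∘ f) (sound d)
    where
    merge : Any (v ⊨_) (φ ⋎ ψ ∷ φ ∷ ψ ∷ Δ) → Any (v ⊨_) (φ ⋎ ψ ∷ Δ)
    merge (here p)                  = here p
    merge (there (here p))          = here (⊨⋎-introˡ p)
    merge (there (there (here p)))  = here (⊨⋎-introʳ p)
    merge (there (there (there p))) = there p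
  sound (→L d e) = rule₂
    (λ { f g (p ∷ γ) → [ (λ q → g (p ∷ ⊨⊃-elim p q ∷ γ)) , id ]′ (Any.toSum (f (p ∷ γ))) })
    (sound d) (sound e)
  sound (→R {Γ} {Δ} {φ} {ψ} d) = rule₁ (λ {v} f γ → merge f γ (v ⊨? φ)) (sound d)
    where
    merge : v ⊨ˢ φ ∷ Γ ⇒ φ ⊃ ψ ∷ ψ ∷ Δ → All (v ⊨_) Γ → Dec (v ⊨ φ) → Any (v ⊨_) (φ ⊃ ψ ∷ Δ)
    merge f γ (no ¬p) = here (⊨⊃-intro (⊥-elim ∘ ¬p))
    merge f γ (yes p) with f (p ∷ γ)
    ... | here q          = here q
    ... | there (here q)  = here (⊨⊃-intro (const q))
    ... | there (there q) = there q
  sound (□4 d) = □4-sound (sound d)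
  sound (□T d) = □T-sound (sound d)
  sound (Mon d e f) = Mon-sound (sound d) (sound e) (sound f)
  sound (D₁ d) = D₁-sound (sound d)
  sound (D₂ d e f) = D₂-sound (sound d) (sound e) (sound f)
  sound (cut {Γ} {Δ} d e) = rule₂
    (λ f g γσ → [ (λ p → Any.++⁺ʳ Δ (g (p ∷ All.++⁻ʳ Γ γσ))) , Any.++⁺ˡ ]′
                (Any.toSum (f (All.++⁻ˡ Γ γσ))))
    (sound d) (sound e)

-- Completeness

-- Formulae are compared through codes, as a direct comparison has 64 cases.
data Tree : Set where
  tip  : ℕ → Tree
  node : ℕ → Tree → Tree → Tree

node-injective : ∀ {m n l l′ r r′} → node m l r ≡ node n l′ r′ → m ≡ n × l ≡ l′ × r ≡ r′
node-injective refl = refl , refl , refl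

_≟ᵗ_ : (x y : Tree) → Dec (x ≡ y)
tip m      ≟ᵗ tip n        = map′ (cong tip) (λ { refl → refl }) (m ≟ⁿ n)
tip _      ≟ᵗ node _ _ _   = no λ ()
node _ _ _ ≟ᵗ tip _        = no λ ()
node m l r ≟ᵗ node n l′ r′ = map′ (λ { (refl , refl , refl) → refl }) node-injective
  (m ≟ⁿ n ×-dec (l ≟ᵗ l′ ×-dec r ≟ᵗ r′))

encode : Formula → Tree
encode (var p)     = tip (suc p)
encode ⊥ᶠ          = tip 0
encode (~ φ)       = node 0 (encode φ) (tip 0)
encode (φ ⋏ ψ)     = node 1 (encode φ) (encode ψ)
encode (φ ⋎ ψ)     = node 2 (encode φ) (encode ψ)
encode (φ ⊃ ψ)     = node 3 (encode φ) (encode ψ)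
encode (□ φ)       = node 4 (encode φ) (tip 0)
encode 𝒪⟨ φ / ψ ⟩  = node 5 (encode φ) (encode ψ)

decode : Tree → Formula
decode (tip zero)    = ⊥ᶠ
decode (tip (suc p)) = var p
decode (node 0 l r)  = ~ decode l
decode (node 1 l r)  = decode l ⋏ decode r
decode (node 2 l r)  = decode l ⋎ decode r
decode (node 3 l r)  = decode l ⊃ decode r
decode (node 4 l r)  = □ decode l
-- Of the tags matched here, `encode` produces only 5; the others receive a default value.
decode (node _ l r)  = 𝒪⟨ decode l / decode r ⟩

-- A left inverse makes `encode` injective, so deciding equality of trees decides it for formulae.
decode-encode : ∀ φ → decode (encode φ) ≡ φ
decode-encode (var p)     = refl
decode-encode ⊥ᶠ          = refl
decode-encode (~ φ)       = cong ~_ (decode-encode φ)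
decode-encode (φ ⋏ ψ)     = cong₂ _⋏_ (decode-encode φ) (decode-encode ψ)
decode-encode (φ ⋎ ψ)     = cong₂ _⋎_ (decode-encode φ) (decode-encode ψ)
decode-encode (φ ⊃ ψ)     = cong₂ _⊃_ (decode-encode φ) (decode-encode ψ)
decode-encode (□ φ)       = cong □_ (decode-encode φ)
decode-encode 𝒪⟨ φ / ψ ⟩  = cong₂ 𝒪⟨_/_⟩ (decode-encode φ) (decode-encode ψ)

_≟_ : (φ ψ : Formula) → Dec (φ ≡ ψ)
φ ≟ ψ = map′
  (λ eq → trans (sym (decode-encode φ)) (trans (cong decode eq) (decode-encode ψ)))
  (cong encode) (encode φ ≟ᵗ encode ψ)

-- Atoms, literals and updated valuations

atoms : Formula → List Formula
atoms (var p)     = [ var p ]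
atoms ⊥ᶠ          = []
atoms (~ φ)       = atoms φ
atoms (φ ⋏ ψ)     = atoms φ ++ atoms ψ
atoms (φ ⋎ ψ)     = atoms φ ++ atoms ψ
atoms (φ ⊃ ψ)     = atoms φ ++ atoms ψ
atoms (□ φ)       = [ □ φ ]
atoms 𝒪⟨ φ / ψ ⟩  = [ 𝒪⟨ φ / ψ ⟩ ]

-- The literals of Kalmár's argument: a negated atom is represented by the atom itself in the
-- succedent.
Literal : (Formula → Bool) → List Formula → List Formula → Formula → Set
Literal v Γ Δ α = (v α ≡ true × α ∈ Γ) ⊎ (v α ≡ false × α ∈ Δ)

_[_≔_] : (Formula → Bool) → Formula → Bool → Formula → Bool
(v [ α ≔ b ]) β = if does (β ≟ α) then b else v β

[≔]-same : ∀ v α b → (v [ α ≔ b ]) α ≡ b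
[≔]-same v α b rewrite dec-true (α ≟ α) refl = refl

[≔]-other : ∀ v {α β} b → β ≢ α → (v [ α ≔ b ]) β ≡ v β
[≔]-other v {α} {β} b β≢α rewrite dec-false (β ≟ α) β≢α = refl

-- Weakening, contraction and cut with shared contexts

module _ {𝒮 : Pred Sequent ℓ} (proper : ([] ⇒ []) ∉ 𝒮) where

  -- `Ψ` holds the active formulae that a modal premiss carries in front of its boxed context.
  weaken-□ : ∀ Ψ Γ → 𝒮 ⊢ᴳᶜ Ψ ++ (Γ ^□ ++ Σ ^□) ⇒ Δ → 𝒮 ⊢ᴳᶜ Ψ ++ (Γ ++ Σ) ^□ ⇒ Δ
  weaken-□ {Σ} {Δ} Ψ Γ =
    subst (λ Ξ → 𝒮 ⊢ᴳᶜ Ψ ++ Ξ ⇒ Δ) (sym (filter-++ isBoxed? Γ Σ))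

  weaken-leaf : ∀ Γ Δ → 𝒮 (Γ ⇒ Δ) → 𝒮 ⊢ᴳᶜ Γ ++ Σ ⇒ Δ ++ Π
  -- The empty leaf offers no cut formula; `proper` excludes it.
  weaken-leaf []      []      m = contradiction m proper
  weaken-leaf {Σ} {Π} (φ ∷ Γ) [] m =
    exch (prep φ (++-comm Σ Γ)) (++-comm Π []) (cut (init {Γ = Σ}) (leaf m))
  weaken-leaf {Σ} {Π} Γ (φ ∷ Δ) m = exch ↭-refl (shift φ Δ Π) (cut (leaf m) init)

  weaken : 𝒮 ⊢ᴳᶜ Γ ⇒ Δ → 𝒮 ⊢ᴳᶜ Γ ++ Σ ⇒ Δ ++ Π
  weaken (leaf {Γ ⇒ Δ} m) = weaken-leaf Γ Δ m
  weaken (exch Γ↭ Δ↭ d) = exch (++⁺ʳ _ Γ↭) (++⁺ʳ _ Δ↭) (weaken d)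
  weaken init       = init
  weaken ⊥L         = ⊥L
  weaken (¬L d)     = ¬L (weaken d)
  weaken (¬R d)     = ¬R (weaken d)
  weaken (∧L d)     = ∧L (weaken d)
  weaken (∧R d e)   = ∧R (weaken d) (weaken e)
  weaken (∨L d e)   = ∨L (weaken d) (weaken e)
  weaken (∨R d)     = ∨R (weaken d)
  weaken (→L d e)   = →L (weaken d) (weaken e)
  weaken (→R d)     = →R (weaken d)
  weaken (□4 {Γ} d) = □4 (weaken-□ [] Γ (weaken d))
  weaken (□T d)     = □T (weaken d)
  weaken (Mon {Γ} {φ = φ} {ψ} {χ = χ} d e f) =
    Mon (weaken-□ [ φ ] Γ (weaken d)) (weaken-□ [ ψ ] Γ (weaken e)) (weaken-□ [ χ ] Γ (weaken f))
  weaken (D₁ {Γ} {φ = φ} d) = D₁ (weaken-□ [ φ ] Γ (weaken d))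
  weaken (D₂ {Γ} {φ = φ} {ψ} {θ} {χ} d e f) =
    D₂ (weaken-□ (φ ∷ θ ∷ []) Γ (weaken d))
       (weaken-□ [ ψ ] Γ (weaken e)) (weaken-□ [ χ ] Γ (weaken f))
  -- Cut concatenates contexts, so the added formulae can enter through the right premiss alone.
  weaken (cut {Γ} {Δ} {Σ} {Π} d e) =
    exch (↭-reflexive (sym (++-assoc Γ Σ _))) (↭-reflexive (sym (++-assoc Δ Π _)))
         (cut d (weaken e))

  exchˡ : 𝒮 ⊢ᴳᶜ φ ∷ ψ ∷ Γ ⇒ Δ → 𝒮 ⊢ᴳᶜ ψ ∷ φ ∷ Γ ⇒ Δ
  exchˡ = exch (swap _ _ ↭-refl) ↭-refl

  exchʳ : 𝒮 ⊢ᴳᶜ Γ ⇒ φ ∷ ψ ∷ Δ → 𝒮 ⊢ᴳᶜ Γ ⇒ ψ ∷ φ ∷ Δ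
  exchʳ = exch ↭-refl (swap _ _ ↭-refl)

  contractˡ : 𝒮 ⊢ᴳᶜ φ ∷ φ ∷ Γ ⇒ Δ → 𝒮 ⊢ᴳᶜ φ ∷ Γ ⇒ Δ
  contractˡ {φ} {Γ} d = cut {Γ = [ φ ]} {Δ = []}
    (∧R (exchʳ init) (exchʳ init))
    -- The premiss of `∧L` retains the principal formula, so `φ ⋏ φ` is first added by weakening.
    (∧L (exch (++-comm (φ ∷ φ ∷ Γ) [ φ ⋏ φ ]) (++-comm _ []) (weaken d)))

  contractʳ : 𝒮 ⊢ᴳᶜ Γ ⇒ φ ∷ φ ∷ Δ → 𝒮 ⊢ᴳᶜ Γ ⇒ φ ∷ Δ
  contractʳ {Γ} {φ} {Δ} d = exch (++-comm Γ []) (++-comm Δ [ φ ])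
    (cut (∨R (exch (++-comm Γ []) (++-comm (φ ∷ φ ∷ Δ) [ φ ⋎ φ ]) (weaken d)))
         (∨L (exchˡ init) (exchˡ init)))

  absorbˡ : φ ∈ Γ → 𝒮 ⊢ᴳᶜ φ ∷ Γ ⇒ Δ → 𝒮 ⊢ᴳᶜ Γ ⇒ Δ
  absorbˡ {φ} m d with ∈-∃++ m
  ... | Γ₁ , Γ₂ , refl = exch (↭-sym (shift φ Γ₁ Γ₂)) ↭-refl
    (contractˡ (exch (prep φ (shift φ Γ₁ Γ₂)) ↭-refl d))

  absorbʳ : φ ∈ Δ → 𝒮 ⊢ᴳᶜ Γ ⇒ φ ∷ Δ → 𝒮 ⊢ᴳᶜ Γ ⇒ Δ
  absorbʳ {φ} m d with ∈-∃++ m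
  ... | Δ₁ , Δ₂ , refl = exch ↭-refl (↭-sym (shift φ Δ₁ Δ₂))
    (contractʳ (exch ↭-refl (prep φ (shift φ Δ₁ Δ₂)) d))

  absorb-allˡ : ∀ Γ → Γ ⊆ Σ → 𝒮 ⊢ᴳᶜ Γ ++ Σ ⇒ Δ → 𝒮 ⊢ᴳᶜ Σ ⇒ Δ
  absorb-allˡ []      Γ⊆ d = d
  absorb-allˡ (φ ∷ Γ) Γ⊆ d =
    absorb-allˡ Γ (Γ⊆ ∘ there) (absorbˡ (xs⊆ys++xs _ Γ (Γ⊆ (here refl))) d)

  absorb-allʳ : ∀ Δ → Δ ⊆ Π → 𝒮 ⊢ᴳᶜ Γ ⇒ Δ ++ Π → 𝒮 ⊢ᴳᶜ Γ ⇒ Π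
  absorb-allʳ []      Δ⊆ d = d
  absorb-allʳ (φ ∷ Δ) Δ⊆ d =
    absorb-allʳ Δ (Δ⊆ ∘ there) (absorbʳ (xs⊆ys++xs _ Δ (Δ⊆ (here refl))) d)

  -- Weakening places all of `Σ` and `Π` beside the sequent, and each old formula is contracted into
  -- its occurrence there. Multiplicity and order cease to matter.
  structural : Γ ⊆ Σ → Δ ⊆ Π → 𝒮 ⊢ᴳᶜ Γ ⇒ Δ → 𝒮 ⊢ᴳᶜ Σ ⇒ Π
  structural Γ⊆ Δ⊆ d = absorb-allʳ _ Δ⊆ (absorb-allˡ _ Γ⊆ (weaken d))

  identity : φ ∈ Γ → φ ∈ Δ → 𝒮 ⊢ᴳᶜ Γ ⇒ Δ
  identity m n = absorbˡ m (absorbʳ n init)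

  shared-cut : 𝒮 ⊢ᴳᶜ Γ ⇒ φ ∷ Δ → 𝒮 ⊢ᴳᶜ φ ∷ Γ ⇒ Δ → 𝒮 ⊢ᴳᶜ Γ ⇒ Δ
  shared-cut d e = absorb-allʳ _ id (absorb-allˡ _ id (cut d e))

  weaken₁ˡ : 𝒮 ⊢ᴳᶜ Γ ⇒ Δ → 𝒮 ⊢ᴳᶜ φ ∷ Γ ⇒ Δ
  weaken₁ˡ = structural there id

  weaken₁ʳ : 𝒮 ⊢ᴳᶜ Γ ⇒ Δ → 𝒮 ⊢ᴳᶜ Γ ⇒ φ ∷ Δ
  weaken₁ʳ = structural id there

  -- Logical rules without the copied principal formula

  ¬L′ : 𝒮 ⊢ᴳᶜ Γ ⇒ φ ∷ Δ → 𝒮 ⊢ᴳᶜ ~ φ ∷ Γ ⇒ Δ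
  ¬L′ d = ¬L (weaken₁ˡ d)

  ¬R′ : 𝒮 ⊢ᴳᶜ φ ∷ Γ ⇒ Δ → 𝒮 ⊢ᴳᶜ Γ ⇒ ~ φ ∷ Δ
  ¬R′ d = ¬R (weaken₁ʳ d)

  ∧L′ : 𝒮 ⊢ᴳᶜ φ ∷ ψ ∷ Γ ⇒ Δ → 𝒮 ⊢ᴳᶜ φ ⋏ ψ ∷ Γ ⇒ Δ
  ∧L′ d = ∧L (weaken₁ˡ d)

  ∧R′ : 𝒮 ⊢ᴳᶜ Γ ⇒ φ ∷ Δ → 𝒮 ⊢ᴳᶜ Γ ⇒ ψ ∷ Δ → 𝒮 ⊢ᴳᶜ Γ ⇒ φ ⋏ ψ ∷ Δ
  ∧R′ d e = ∧R (weaken₁ʳ d) (weaken₁ʳ e)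

  ∨L′ : 𝒮 ⊢ᴳᶜ φ ∷ Γ ⇒ Δ → 𝒮 ⊢ᴳᶜ ψ ∷ Γ ⇒ Δ → 𝒮 ⊢ᴳᶜ φ ⋎ ψ ∷ Γ ⇒ Δ
  ∨L′ d e = ∨L (weaken₁ˡ d) (weaken₁ˡ e)

  ∨R′ : 𝒮 ⊢ᴳᶜ Γ ⇒ φ ∷ ψ ∷ Δ → 𝒮 ⊢ᴳᶜ Γ ⇒ φ ⋎ ψ ∷ Δ
  ∨R′ d = ∨R (weaken₁ʳ d)

  →L′ : 𝒮 ⊢ᴳᶜ Γ ⇒ φ ∷ Δ → 𝒮 ⊢ᴳᶜ ψ ∷ Γ ⇒ Δ → 𝒮 ⊢ᴳᶜ φ ⊃ ψ ∷ Γ ⇒ Δ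
  →L′ d e = →L (weaken₁ˡ d) (weaken₁ˡ e)

  →R′ : 𝒮 ⊢ᴳᶜ φ ∷ Γ ⇒ ψ ∷ Δ → 𝒮 ⊢ᴳᶜ Γ ⇒ φ ⊃ ψ ∷ Δ
  →R′ d = →R (weaken₁ʳ d)

  □T′ : 𝒮 ⊢ᴳᶜ φ ∷ Γ ⇒ Δ → 𝒮 ⊢ᴳᶜ □ φ ∷ Γ ⇒ Δ
  □T′ d = □T (weaken₁ˡ d)

  modus-ponens : 𝒮 ⊢ᴳᶜ φ ⊃ ψ ∷ φ ∷ Γ ⇒ ψ ∷ Δ
  modus-ponens = →L′ init init

  -- Contexts against their conjunctions and disjunctions

  ⋀L : ∀ Γ → 𝒮 ⊢ᴳᶜ Γ ++ Σ ⇒ Δ → 𝒮 ⊢ᴳᶜ ⋀ Γ ∷ Σ ⇒ Δ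
  ⋀L []          d = weaken₁ˡ d
  ⋀L (φ ∷ [])    d = d
  ⋀L {Σ} (φ ∷ ψ ∷ Γ) d = ∧L′ (exchˡ (⋀L (ψ ∷ Γ) (exch (↭-sym (shift φ (ψ ∷ Γ) Σ)) ↭-refl d)))

  ⋀R : ∀ Γ → 𝒮 ⊢ᴳᶜ Γ ⇒ [ ⋀ Γ ]
  ⋀R []          = →R′ init
  ⋀R (φ ∷ [])    = init
  ⋀R (φ ∷ ψ ∷ Γ) = ∧R′ init (weaken₁ˡ (⋀R (ψ ∷ Γ)))

  ⋁R : ∀ Δ → 𝒮 ⊢ᴳᶜ Γ ⇒ Δ ++ Π → 𝒮 ⊢ᴳᶜ Γ ⇒ ⋁ Δ ∷ Π
  ⋁R []          d = weaken₁ʳ d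
  ⋁R (φ ∷ [])    d = d
  ⋁R {Π = Π} (φ ∷ ψ ∷ Δ) d = ∨R′ (exchʳ (⋁R (ψ ∷ Δ) (exch ↭-refl (↭-sym (shift φ (ψ ∷ Δ) Π)) d)))

  ⋁L : ∀ Δ → 𝒮 ⊢ᴳᶜ [ ⋁ Δ ] ⇒ Δ
  ⋁L []          = ⊥L
  ⋁L (φ ∷ [])    = init
  ⋁L (φ ∷ ψ ∷ Δ) = ∨L′ init (weaken₁ʳ (⋁L (ψ ∷ Δ)))

  -- Kalmár's argument for tautologies

  Settled : List Formula → List Formula → Formula → Bool → Set ℓ
  Settled Γ Δ φ true  = 𝒮 ⊢ᴳᶜ Γ ⇒ φ ∷ Δ
  Settled Γ Δ φ false = 𝒮 ⊢ᴳᶜ φ ∷ Γ ⇒ Δ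

  settled-literal : ∀ v φ → Literal v Γ Δ φ → Settled Γ Δ φ (v φ)
  settled-literal v φ (inj₁ (eq , m)) rewrite eq = identity m (here refl)
  settled-literal v φ (inj₂ (eq , m)) rewrite eq = identity (here refl) m

  kalmár : ∀ φ → All (Literal v Γ Δ) (atoms φ) → Settled Γ Δ φ (eval v φ)
  kalmár {v} (var p)    (l ∷ []) = settled-literal v (var p) l
  kalmár {v} (□ φ)      (l ∷ []) = settled-literal v (□ φ) l
  kalmár {v} 𝒪⟨ φ / ψ ⟩ (l ∷ []) = settled-literal v 𝒪⟨ φ / ψ ⟩ l
  kalmár ⊥ᶠ             _        = ⊥L
  kalmár {v} (~ φ)   ls with eval v φ | kalmár φ ls
  ... | true  | d = ¬L′ d
  ... | false | d = ¬R′ d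
  kalmár {v} (φ ⋏ ψ) ls with eval v φ | kalmár φ (All.++⁻ˡ (atoms φ) ls)
                           | eval v ψ | kalmár ψ (All.++⁻ʳ (atoms φ) ls)
  ... | true  | d | true  | e = ∧R′ d e
  ... | true  | d | false | e = ∧L′ (weaken₁ˡ e)
  ... | false | d | _     | e = ∧L′ (exchˡ (weaken₁ˡ d))
  kalmár {v} (φ ⋎ ψ) ls with eval v φ | kalmár φ (All.++⁻ˡ (atoms φ) ls)
                           | eval v ψ | kalmár ψ (All.++⁻ʳ (atoms φ) ls)
  ... | true  | d | _     | e = ∨R′ (exchʳ (weaken₁ʳ d))
  ... | false | d | true  | e = ∨R′ (weaken₁ʳ e)
  ... | false | d | false | e = ∨L′ d e
  kalmár {v} (φ ⊃ ψ) ls with eval v φ | kalmár φ (All.++⁻ˡ (atoms φ) ls)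
                           | eval v ψ | kalmár ψ (All.++⁻ʳ (atoms φ) ls)
  ... | false | d | _     | e = →R′ (weaken₁ʳ d)
  ... | true  | d | true  | e = →R′ (weaken₁ˡ e)
  ... | true  | d | false | e = →L′ d e

  -- The invariant is that each atom of `φ` is pending or already a literal. The next pending atom
  -- joins the succedent in one branch and the antecedent in the other, and the branches are the
  -- premisses of a cut on it. With none pending, the valuation settles `φ`, as true because it is a
  -- tautology.
  eliminate-literals : ∀ pending {v Γ Δ} → Tautology φ →
    All (λ α → α ∈ pending ⊎ Literal v Γ Δ α) (atoms φ) → 𝒮 ⊢ᴳᶜ Γ ⇒ φ ∷ Δ
  eliminate-literals {φ} [] {v} {Γ} {Δ} t ls = subst (Settled Γ Δ φ) (t v)
    (kalmár φ (All.map [ (λ ()) , id ]′ ls))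
  eliminate-literals (α ∷ pending) {v} t ls = shared-cut
    (exchʳ (eliminate-literals pending t (All.map (assign false) ls)))
    (eliminate-literals pending t (All.map (assign true) ls))
    where
    extendˡ extendʳ : Bool → List Formula → List Formula
    extendˡ b Γ = if b then α ∷ Γ else Γ
    extendʳ b Δ = if b then Δ else α ∷ Δ

    assign : ∀ b {β} → β ∈ α ∷ pending ⊎ Literal v Γ Δ β →
      β ∈ pending ⊎ Literal (v [ α ≔ b ]) (extendˡ b Γ) (extendʳ b Δ) β
    assign b {β} l with β ≟ α
    -- `pending` may repeat an atom. The latest value then overrides the earlier one, witnessed by
    -- the new occurrence; the old occurrence stays in the sequent harmlessly.
    assign true  _ | yes refl = inj₂ (inj₁ ([≔]-same v α true , here refl))
    assign false _ | yes refl = inj₂ (inj₂ ([≔]-same v α false , here refl))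
    assign b (inj₁ (here β≡α)) | no β≢α = contradiction β≡α β≢α
    assign b (inj₁ (there m))  | no β≢α = inj₁ m
    assign true  (inj₂ (inj₁ (eq , m))) | no β≢α =
      inj₂ (inj₁ (trans ([≔]-other v true β≢α) eq , there m))
    assign true  (inj₂ (inj₂ (eq , m))) | no β≢α =
      inj₂ (inj₂ (trans ([≔]-other v true β≢α) eq , m))
    assign false (inj₂ (inj₁ (eq , m))) | no β≢α =
      inj₂ (inj₁ (trans ([≔]-other v false β≢α) eq , m))
    assign false (inj₂ (inj₂ (eq , m))) | no β≢α =
      inj₂ (inj₂ (trans ([≔]-other v false β≢α) eq , there m))

  tautology-complete : Tautology φ → 𝒮 ⊢ᴳᶜ [] ⇒ [ φ ]
  tautology-complete {φ} t =
    -- The starting valuation is arbitrary: all atoms of `φ` are pending and are reassigned before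
    -- it is consulted.
    eliminate-literals (atoms φ) {v = const true} t (All.tabulate inj₁)

  -- Hilbert derivations as sequent derivations

  complete : Interpretations 𝒮 ⊢ φ → 𝒮 ⊢ᴳᶜ [] ⇒ [ φ ]
  complete (assumption ((Γ ⇒ Δ) , m , refl)) =
    →R′ (⋁R Δ (⋀L Γ (exch (++-comm [] Γ) (++-comm [] Δ) (leaf m))))
  complete (tautology t) = tautology-complete t
  complete (axiomK φ ψ) =
    →R′ (→R′ (□4 (□T′ (exchˡ (□T′ modus-ponens)))))
  complete (axiomT φ) = →R′ (□T′ init)
  complete (axiom4 φ) = →R′ (□4 (□4 (□T′ init)))
  complete (axiom𝒪₁ φ ψ θ) =
    →R′ (∧L′ (exchˡ (Mon (exchˡ (□T′ modus-ponens)) init init)))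
  complete (axiom𝒪₂ φ ψ θ) =
    -- Both obligations have the condition `θ`, so the last two premisses of `D₂` are initial.
    →R′ (¬R′ (∧L′ (D₂ (exch (++-comm [ □ (ψ ⊃ ~ φ) ] (φ ∷ ψ ∷ [])) ↭-refl
      (□T′ (→L′ (exchˡ init) (¬L′ init)))) init init)))
  complete (axiom𝒪₃ φ ψ θ) =
    →R′ (∧L′ (exchˡ (Mon init
      (exchˡ (□T′ (∧L′ (exchˡ (weaken₁ˡ modus-ponens)))))
      (exchˡ (□T′ (∧L′ (weaken₁ˡ modus-ponens)))))))
  -- `φ` and then `φ ⊃ ψ` are cut against the sequent `modus-ponens`.
  complete (mp d e) = shared-cut (exchʳ (weaken₁ʳ (complete e)))
    (shared-cut (weaken₁ˡ (exchʳ (weaken₁ʳ (complete d)))) modus-ponens)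
  -- The antecedent is empty, so restricting it to boxed formulae changes nothing.
  complete (nec d) = □4 (complete d)

theorem2 : ∀ {ℓ} (𝒮 : Pred Sequent ℓ) (Γ Δ : List Formula) →
    (𝒮 ⊢ᴳᶜ (Γ ⇒ Δ) → Interpretations 𝒮 ⊢ (⋀ Γ ⊃ ⋁ Δ)) ×
    (([] ⇒ []) ∉ 𝒮 → Interpretations 𝒮 ⊢ (⋀ Γ ⊃ ⋁ Δ) → 𝒮 ⊢ᴳᶜ (Γ ⇒ Δ))
theorem2 𝒮 Γ Δ = derivation ∘ sound , λ proper d →
  -- The derived implication is cut against its own decomposition, the sequent `⋀ Γ ⊃ ⋁ Δ ∷ Γ ⇒ Δ`.
  cut (complete proper d)
      (→L′ proper (structural proper id (xs⊆xs++ys _ Δ) (⋀R proper Γ))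
                  (structural proper (xs⊆xs++ys _ Γ) id (⋁L proper Δ)))
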